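{- For all positive integers $n,h,k$ we have $\mathrm{ex}(n,\mathit{St}_3(h,k))\lesssim \max\{kn^2,h^2k^2n\}$, i.e. there is an absolute constant $C$ such that every $3$-graph on $n$ vertices with more than $C\max\{kn^2,h^2k^2n\}$ edges contains a copy of $\mathit{St}_3(h,k)$.
   Context: A $3$-graph is a $3$-uniform hypergraph; $\mathrm{ex}(n,\mathcal{F})$ is the maximum number of edges of an $n$-vertex $3$-graph with no copy of $\mathcal{F}$. $\mathit{St}_3(h,k)$ is the $3$-graph with a vertex $v$ contained in all edges such that removing $v$ from every edge yields $h$ vertex-disjoint copies of the graph star $S_k$ (a star with $k$ leaves); it has $hk$ edges and $1+h+hk$ vertices. -}

module Defs where

open import Data.Nat using (ℕ)
open import Data.Fin using (Fin; _<_)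
open import Data.Product using (Σ; ∃; _×_; _,_)
open import Data.Sum using (_⊎_)
open import Data.Unit using (⊤)
open import Data.List using (List; length)
open import Data.List.Relation.Unary.Unique.Propositional using (Unique)
open import Data.List.Membership.Propositional using (_∈_)
open import Relation.Binary.PropositionalEquality using (_≡_)
open import Function.Definitions using (Injective)

record Edge3 (n : ℕ) : Set where
  constructor edge
  field
    a b c : Fin n
    a<b : a < b
    b<c : b < c
open Edge3 public

record Graph3 (n : ℕ) : Set where
  constructor graph3
  field
    edges  : List (Edge3 n)
    unique : Unique edges
open Graph3 public

e : ∀ {n} → Graph3 n → ℕ
e G = length (edges G)

_∈ₑ_ : ∀ {n} → Fin n → Edge3 n → Set
x ∈ₑ ed = x ≡ a ed ⊎ x ≡ b ed ⊎ x ≡ c ed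

-- {x,y,z} is an edge of G (x,y,z pairwise distinct is guaranteed by
-- injectivity where this is used; then {x,y,z} ⊆ ed forces equality of sets)
HasEdge : ∀ {n} → Graph3 n → Fin n → Fin n → Fin n → Set
HasEdge G x y z = Σ (Edge3 _) λ ed → ed ∈ edges G × (x ∈ₑ ed × y ∈ₑ ed × z ∈ₑ ed)

-- vertices of St_3(h,k): the apex, h star centres, and h·k leaves
StVertex : ℕ → ℕ → Set
StVertex h k = ⊤ ⊎ Fin h ⊎ (Fin h × Fin k)

ContainsSt3 : ∀ {n} → Graph3 n → ℕ → ℕ → Set
ContainsSt3 {n} G h k =
  Σ (StVertex h k → Fin n) λ φ →
    Injective _≡_ _≡_ φ ×
    (∀ (i : Fin h) (j : Fin k) →
       HasEdge G (φ (Data.Sum.inj₁ Data.Unit.tt))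
                 (φ (Data.Sum.inj₂ (Data.Sum.inj₁ i)))
                 (φ (Data.Sum.inj₂ (Data.Sum.inj₂ (i , j)))))

{-# OPTIONS --safe #-}
module Submission where

open import Defs
open import Data.Nat using (ℕ; _*_; _^_; _<_; _≤_; _⊔_)
open import Data.Product using (∃)
open import Data.Nat using (zero; suc; _+_; z≤n; s≤s; _≤?_)
open import Data.Nat.Properties hiding (_≟_)
open import Data.Nat.Tactic.RingSolver using (solve-∀)
open import Data.Empty using (⊥-elim)
open import Data.Fin as Fin using (Fin; zero; suc; inject≤)
open import Data.Fin.Properties as Fin using (_≟_; any?; injective⇒≤; inject≤-injective)
open import Data.List
  using (List; []; _∷_; _++_; length; lookup; map; concatMap; filter; take; allFin; tabulate; cartesianProduct)
open import Data.List.Properties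
  using (length-map; length-++; length-tabulate; length-filter; length-take; filter-≐)
open import Data.List.Membership.Propositional using (_∈_; _∉_; find; lose)
open import Data.List.Membership.Propositional.Properties
open import Data.List.Relation.Binary.Disjoint.Propositional using (Disjoint)
open import Data.List.Relation.Binary.Subset.Propositional using (_⊆_)
open import Data.List.Relation.Unary.All as All using (All; []; _∷_)
import Data.List.Relation.Unary.All.Properties as All
open import Data.List.Relation.Unary.AllPairs using (_∷_)
open import Data.List.Relation.Unary.Any as Any using (here; there; index)
open import Data.List.Relation.Unary.Any.Properties using (lookup-index)
open import Data.List.Relation.Unary.Unique.Propositional using (Unique)
import Data.List.Relation.Unary.Unique.Propositional.Properties as Unique
open import Data.Product using (_×_; _,_; proj₁; proj₂; swap; uncurry)
open import Data.Sum as Sum using (_⊎_; inj₁; inj₂)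
open import Function using (_∘_; case_of_)
open import Function.Definitions using (Injective)
open import Level using (0ℓ)
open import Relation.Binary using (Rel; Decidable; Symmetric)
open import Relation.Binary.PropositionalEquality
open import Relation.Nullary using (Dec; yes; no; ¬_; contradiction)
open import Relation.Nullary.Decidable using (map′; ¬?; _×-dec_; _⊎-dec_)

-- Put D = h (k + 1) and call a pair heavy if it lies in at least D edges.  If
-- some w has h heavy partners, these are the centres of h disjoint k-stars in
-- the link of w, whose leaves can be chosen greedily.  Otherwise, in the link
-- of w keep only the pairs uv which are heavy themselves or for which neither
-- wu nor wv is heavy.  The resulting graph has maximum degree at most D.  If h
-- disjoint k-stars cannot be picked greedily from it, some set of at most D
-- vertices meets all but nk of its arcs, so it has at most 2D² + nk arcs.
-- Every edge of G is kept in the link of one of its vertices, namely the one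
-- opposite a heavy pair if there is such a pair, so summing over w gives
-- e(G) ≤ n (2D² + nk), and D ≤ 2hk.  Bounding the full links instead would cost
-- an additional term hn².

-- Counting in lists without repetition.

lookup-injective : ∀ {A : Set} {xs : List A} → Unique xs → Injective _≡_ _≡_ (lookup xs)
lookup-injective (_ ∷ _)    {zero}  {zero}  _  = refl
lookup-injective (x∉xs ∷ _) {zero}  {suc j} eq = contradiction eq (All.lookup x∉xs (∈-lookup j))
lookup-injective (x∉xs ∷ _) {suc i} {zero}  eq = contradiction (sym eq) (All.lookup x∉xs (∈-lookup i))
lookup-injective (_ ∷ uniq) {suc i} {suc j} eq = cong suc (lookup-injective uniq eq)

-- Sending a position in `xs` to a position of the same element in `ys` is an injection between the
-- index sets.
Unique-⊆⇒length≤ : ∀ {A : Set} {xs ys : List A} → Unique xs → xs ⊆ ys → length xs ≤ length ys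
Unique-⊆⇒length≤ {ys = ys} uniq xs⊆ys =
  injective⇒≤ {f = λ i → index (xs⊆ys (∈-lookup i))} λ {i} {j} eq →
    lookup-injective uniq
      (trans (lookup-index (xs⊆ys (∈-lookup i)))
        (trans (cong (lookup ys) eq) (sym (lookup-index (xs⊆ys (∈-lookup j))))))

length-concatMap-≤ : ∀ {A B : Set} (f : A → List B) (xs : List A) {b} →
  (∀ {x} → x ∈ xs → length (f x) ≤ b) → length (concatMap f xs) ≤ length xs * b
length-concatMap-≤ f []       bound = z≤n
length-concatMap-≤ f (x ∷ xs) bound = ≤-trans (≤-reflexive (length-++ (f x)))
  (+-mono-≤ (bound (here refl)) (length-concatMap-≤ f xs (bound ∘ there)))

-- Families of disjoint stars in a relation.

module _ {n : ℕ} where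

  open import Data.List.Membership.DecPropositional (_≟_ {n}) using (_∈?_)

  record Star (R : Rel (Fin n) 0ℓ) (k : ℕ) : Set where
    field
      centre         : Fin n
      leaf           : Fin k → Fin n
      leaf-injective : Injective _≡_ _≡_ leaf
      adjacent       : ∀ j → R centre (leaf j)

    vertices : List (Fin n)
    vertices = centre ∷ tabulate leaf

    -- The invariant of both greedy constructions: the `suc k` vertices of a chosen star pass from
    -- the budget of stars still to be chosen into the forbidden list.
    length-vertices-++ : ∀ h X → h * suc k + length (vertices ++ X) ≡ suc h * suc k + length X
    length-vertices-++ h X = begin
      h * suc k + length (vertices ++ X)          ≡⟨ cong (h * suc k +_) (length-++ vertices) ⟩
      h * suc k + (length vertices + length X)    ≡⟨ cong (λ m → h * suc k + (suc m + length X)) (length-tabulate leaf) ⟩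
      h * suc k + (suc k + length X)              ≡⟨ +-assoc (h * suc k) (suc k) (length X) ⟨
      h * suc k + suc k + length X                ≡⟨ cong (_+ length X) (+-comm (h * suc k) (suc k)) ⟩
      suc h * suc k + length X                    ∎
      where open ≡-Reasoning

    vertices-disjoint : ∀ {X} → centre ∉ X → (∀ j → leaf j ∉ X) → Disjoint vertices X
    vertices-disjoint centre∉ leaf∉ (here refl , ∈X) = centre∉ ∈X
    vertices-disjoint centre∉ leaf∉ (there ∈leaves , ∈X) with ∈-tabulate⁻ ∈leaves
    ... | j , refl = leaf∉ j ∈X

  open Star

  -- `X` lists the forbidden vertices. It grows by each chosen star, so pairwise disjointness is
  -- recorded only as avoidance of `X`.
  data Stars (R : Rel (Fin n) 0ℓ) (k : ℕ) : ℕ → List (Fin n) → Set where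
    []   : ∀ {X} → Stars R k 0 X
    cons : ∀ {h X} (s : Star R k) → Disjoint (vertices s) X →
           Stars R k h (vertices s ++ X) → Stars R k (suc h) X

  module _ {R : Rel (Fin n) 0ℓ} {k : ℕ} where

    star : ∀ {h X} → Stars R k h X → Fin h → Star R k
    star (cons s _ ss) zero    = s
    star (cons s _ ss) (suc i) = star ss i

    star-avoids : ∀ {h X} (ss : Stars R k h X) i → Disjoint (vertices (star ss i)) X
    star-avoids (cons s s∩X ss) zero             = s∩X
    star-avoids (cons s s∩X ss) (suc i) (∈s , ∈X) = star-avoids ss i (∈s , ∈-++⁺ʳ (vertices s) ∈X)

    -- Of two different stars the later one avoids a list that contains the earlier one.
    star-unique : ∀ {h X} (ss : Stars R k h X) {x} i j →
      x ∈ vertices (star ss i) → x ∈ vertices (star ss j) → i ≡ j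
    star-unique (cons s _ ss) zero    zero    _  _  = refl
    star-unique (cons s _ ss) zero    (suc j) p  q  = ⊥-elim (star-avoids ss j (q , ∈-++⁺ˡ p))
    star-unique (cons s _ ss) (suc i) zero    p  q  = ⊥-elim (star-avoids ss i (p , ∈-++⁺ˡ q))
    star-unique (cons s _ ss) (suc i) (suc j) p  q  = cong suc (star-unique ss i j p q)

  -- Neighbourhoods, arcs and the greedy choice of stars.

  module _ {R : Rel (Fin n) 0ℓ} (R? : Decidable R) where

    neighbours : Fin n → List (Fin n)
    neighbours u = filter (R? u) (allFin n)

    ∈-neighbours⁺ : ∀ {u v} → R u v → v ∈ neighbours u
    ∈-neighbours⁺ {u} {v} = ∈-filter⁺ (R? u) (∈-allFin v)

    ∈-neighbours⁻ : ∀ {u v} → v ∈ neighbours u → R u v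
    ∈-neighbours⁻ {u} = proj₂ ∘ ∈-filter⁻ (R? u) {xs = allFin n}

    neighbours-unique : ∀ u → Unique (neighbours u)
    neighbours-unique u = Unique.filter⁺ (R? u) (Unique.allFin⁺ n)

    degree : Fin n → ℕ
    degree u = length (neighbours u)

    arcs : List (Fin n × Fin n)
    arcs = filter (uncurry R?) (cartesianProduct (allFin n) (allFin n))

    ∈-arcs⁺ : ∀ {u v} → R u v → (u , v) ∈ arcs
    ∈-arcs⁺ {u} {v} = ∈-filter⁺ (uncurry R?) (∈-cartesianProduct⁺ (∈-allFin u) (∈-allFin v))

    ∈-arcs⁻ : ∀ {u v} → (u , v) ∈ arcs → R u v
    ∈-arcs⁻ = proj₂ ∘ ∈-filter⁻ (uncurry R?) {xs = cartesianProduct (allFin n) (allFin n)}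

    arcs-unique : Unique arcs
    arcs-unique = Unique.filter⁺ (uncurry R?) (Unique.cartesianProduct⁺ (Unique.allFin⁺ n) (Unique.allFin⁺ n))

    outside : List (Fin n) → Fin n → List (Fin n)
    outside X u = filter (λ v → ¬? (v ∈? X)) (neighbours u)

    degree≤ : ∀ X u → degree u ≤ length X + length (outside X u)
    degree≤ X u = ≤-trans (Unique-⊆⇒length≤ (neighbours-unique u) cover) (≤-reflexive (length-++ X))
      where
      cover : neighbours u ⊆ X ++ outside X u
      cover {v} v∈N with v ∈? X
      ... | yes v∈X = ∈-++⁺ˡ v∈X
      ... | no  v∉X = ∈-++⁺ʳ X (∈-filter⁺ (λ v → ¬? (v ∈? X)) v∈N v∉X)

    module _ {k : ℕ} (X : List (Fin n)) (u : Fin n) (k≤ : k ≤ length (outside X u)) where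

      private
        leaves∈ : ∀ j → lookup (outside X u) (inject≤ j k≤) ∈ neighbours u × lookup (outside X u) (inject≤ j k≤) ∉ X
        leaves∈ j = ∈-filter⁻ (λ v → ¬? (v ∈? X)) {xs = neighbours u} (∈-lookup (inject≤ j k≤))

      starAt : Star R k
      starAt = record
        { centre         = u
        ; leaf           = λ j → lookup (outside X u) (inject≤ j k≤)
        ; leaf-injective = λ {i} {j} eq → inject≤-injective k≤ k≤ i j
            (lookup-injective (Unique.filter⁺ _ (neighbours-unique u)) eq)
        ; adjacent       = ∈-neighbours⁻ ∘ proj₁ ∘ leaves∈
        }

      leaf-starAt∉ : ∀ j → leaf starAt j ∉ X
      leaf-starAt∉ = proj₂ ∘ leaves∈

    -- With the centres prescribed, degree `D` leaves `k` neighbours of each centre after the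
    -- forbidden vertices and the remaining centres are excluded.
    starsAt : ∀ {k D} cs X → Unique cs → All (λ c → D ≤ degree c) cs → Disjoint cs X →
      length cs * suc k + length X ≤ D → Stars R k (length cs) X
    starsAt [] X _ _ _ _ = []
    starsAt {k} {D} (c ∷ cs) X (c∉cs ∷ uniq) (D≤ ∷ D≤s) cs∩X room =
      cons s (vertices-disjoint s (λ c∈X → cs∩X (here refl , c∈X)) (λ j → leaf∉ j ∘ ∈-++⁺ʳ (c ∷ cs)))
        (starsAt cs (vertices s ++ X) uniq D≤s cs∩s++X
          (≤-trans (≤-reflexive (length-vertices-++ s (length cs) X)) room))
      where
      open ≤-Reasoning
      -- The new leaves must also avoid the centres still waiting for their stars.
      Y = (c ∷ cs) ++ X
      enough : k ≤ length (outside Y c)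
      enough = +-cancelˡ-≤ (length Y) k _ (begin
        length Y + k                           ≡⟨ cong (_+ k) (length-++ (c ∷ cs)) ⟩
        suc (length cs) + length X + k         ≡⟨ shuffle (length cs) (length X) k ⟩
        -- A waiting centre excludes one vertex, which its own share `suc k` of the budget covers.
        suc k + length cs * 1 + length X       ≤⟨ +-monoˡ-≤ (length X) (+-monoʳ-≤ (suc k) (*-monoʳ-≤ (length cs) (s≤s z≤n))) ⟩
        suc k + length cs * suc k + length X   ≤⟨ room ⟩
        D                                      ≤⟨ D≤ ⟩
        degree c                               ≤⟨ degree≤ Y c ⟩
        length Y + length (outside Y c)        ∎)
        where
        shuffle : ∀ a b k → suc a + b + k ≡ suc k + a * 1 + b
        shuffle = solve-∀
      s = starAt Y c enough
      leaf∉ = leaf-starAt∉ Y c enough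
      cs∩s++X : Disjoint cs (vertices s ++ X)
      cs∩s++X (v∈cs , v∈) with ∈-++⁻ (vertices s) v∈
      ... | inj₂ v∈X = cs∩X (there v∈cs , v∈X)
      ... | inj₁ v∈s = vertices-disjoint s (λ c∈cs → All.lookup c∉cs c∈cs refl) (λ j → leaf∉ j ∘ there ∘ ∈-++⁺ˡ) (v∈s , v∈cs)

    module _ (R-sym : Symmetric R) {Δ : ℕ} (degree≤Δ : ∀ u → degree u ≤ Δ) where

      -- Arcs leaving `X` and arcs entering `X` number at most `Δ` for each vertex of `X`; the
      -- others are counted by their source, at most `k` for each.
      length-arcs≤ : ∀ {k} X → (∀ {u} → u ∉ X → length (outside X u) ≤ k) →
        length arcs ≤ length X * Δ + (length X * Δ + n * k)
      length-arcs≤ {k} X outside≤k = begin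
        length arcs                                          ≤⟨ Unique-⊆⇒length≤ arcs-unique cover ⟩
        length (from ++ to ++ rest)                          ≡⟨ length-++ from ⟩
        length from + length (to ++ rest)                    ≡⟨ cong (length from +_) (length-++ to) ⟩
        length from + (length to + length rest)              ≤⟨ +-mono-≤ from≤ (+-mono-≤ to≤ rest≤) ⟩
        length X * Δ + (length X * Δ + n * k)                ∎
        where
        open ≤-Reasoning
        ∉X? : ∀ u → Dec (u ∉ X)
        ∉X? u = ¬? (u ∈? X)
        outsiders = filter ∉X? (allFin n)
        from = concatMap (λ u → map (u ,_) (neighbours u)) X
        -- By symmetry the sources of the arcs into `v` are the neighbours of `v`.
        to   = concatMap (λ v → map (_, v) (neighbours v)) X
        rest = concatMap (λ u → map (u ,_) (outside X u)) outsiders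
        cover : arcs ⊆ from ++ to ++ rest
        cover {u , v} uv∈ with u ∈? X | v ∈? X
        ... | yes u∈X | _ = ∈-++⁺ˡ (∈-concatMap⁺ (λ u → map (u ,_) (neighbours u))
              (lose u∈X (∈-map⁺ (u ,_) (∈-neighbours⁺ (∈-arcs⁻ uv∈)))))
        ... | no _ | yes v∈X = ∈-++⁺ʳ from (∈-++⁺ˡ (∈-concatMap⁺ (λ v → map (_, v) (neighbours v))
              (lose v∈X (∈-map⁺ (_, v) (∈-neighbours⁺ (R-sym (∈-arcs⁻ uv∈)))))))
        ... | no u∉X | no v∉X = ∈-++⁺ʳ from (∈-++⁺ʳ to (∈-concatMap⁺ (λ u → map (u ,_) (outside X u))
              (lose (∈-filter⁺ ∉X? (∈-allFin u) u∉X)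
                (∈-map⁺ (u ,_) (∈-filter⁺ ∉X? (∈-neighbours⁺ (∈-arcs⁻ uv∈)) v∉X)))))
        from≤ : length from ≤ length X * Δ
        from≤ = length-concatMap-≤ _ X λ {u} _ → ≤-trans (≤-reflexive (length-map _ (neighbours u))) (degree≤Δ u)
        to≤ : length to ≤ length X * Δ
        to≤ = length-concatMap-≤ _ X λ {v} _ → ≤-trans (≤-reflexive (length-map _ (neighbours v))) (degree≤Δ v)
        rest≤ : length rest ≤ n * k
        rest≤ = begin
          length rest           ≤⟨ length-concatMap-≤ _ outsiders (λ {u} u∈ → ≤-trans (≤-reflexive (length-map _ (outside X u)))
                                     (outside≤k (proj₂ (∈-filter⁻ ∉X? {xs = allFin n} u∈)))) ⟩
          length outsiders * k  ≤⟨ *-monoˡ-≤ k (≤-trans (length-filter ∉X? (allFin n)) (≤-reflexive (length-tabulate {n = n} (λ u → u)))) ⟩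
          n * k                 ∎

      -- `M` bounds the number of forbidden vertices at every stage. If no vertex outside `X` has
      -- `k` neighbours outside `X`, then `length-arcs≤` contradicts the number of arcs.
      greedyStars : ∀ {k M} → M * Δ + (M * Δ + n * k) < length arcs →
        ∀ h X → h * suc k + length X ≤ M → Stars R k h X
      greedyStars many zero X room = []
      greedyStars {k} {M} many (suc h) X room
        with any? (λ u → ¬? (u ∈? X) ×-dec (k ≤? length (outside X u)))
      ... | yes (u , u∉X , k≤) =
        cons s (vertices-disjoint s u∉X (leaf-starAt∉ X u k≤))
          (greedyStars many h (vertices s ++ X) (≤-trans (≤-reflexive (length-vertices-++ s h X)) room))
        where
        s = starAt X u k≤
      ... | no ∄u = contradiction many (≤⇒≯ (begin
        length arcs                            ≤⟨ length-arcs≤ X (λ {u} u∉X → <⇒≤ (≰⇒> (λ k≤ → ∄u (u , u∉X , k≤)))) ⟩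
        length X * Δ + (length X * Δ + n * k)  ≤⟨ +-mono-≤ X≤M (+-monoˡ-≤ (n * k) X≤M) ⟩
        M * Δ + (M * Δ + n * k)                ∎))
        where
        open ≤-Reasoning
        X≤M = *-monoˡ-≤ Δ (m+n≤o⇒n≤o (suc h * suc k) room)

module _ {n : ℕ} {R S : Rel (Fin n) 0ℓ} (R? : Decidable R) (S? : Decidable S) where

  degree-mono : ∀ {u} → (∀ {v} → R u v → S u v) → degree R? u ≤ degree S? u
  degree-mono {u} R⇒S = Unique-⊆⇒length≤ (neighbours-unique R? u) (∈-neighbours⁺ S? ∘ R⇒S ∘ ∈-neighbours⁻ R?)

-- Edges and links of a 3-graph.

module _ {n : ℕ} where

  a<c : (ed : Edge3 n) → a ed Fin.< c ed
  a<c ed = Fin.<-trans (a<b ed) (b<c ed)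

  a≢b : (ed : Edge3 n) → a ed ≢ b ed
  a≢b ed = Fin.<⇒≢ (a<b ed)

  b≢c : (ed : Edge3 n) → b ed ≢ c ed
  b≢c ed = Fin.<⇒≢ (b<c ed)

  a≢c : (ed : Edge3 n) → a ed ≢ c ed
  a≢c ed = Fin.<⇒≢ (a<c ed)

  edge-≡ : ∀ {ed ed′ : Edge3 n} → a ed ≡ a ed′ → b ed ≡ b ed′ → c ed ≡ c ed′ → ed ≡ ed′
  edge-≡ {edge _ _ _ p q} {edge _ _ _ p′ q′} refl refl refl =
    cong₂ (edge _ _ _) (Fin.<-irrelevant p p′) (Fin.<-irrelevant q q′)

module _ {n : ℕ} (G : Graph3 n) where

  HasEdge? : ∀ x y z → Dec (HasEdge G x y z)
  HasEdge? x y z = map′ find (λ (_ , ed∈ , p) → lose ed∈ p)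
    (Any.any? (λ ed → x ∈ₑ? ed ×-dec y ∈ₑ? ed ×-dec z ∈ₑ? ed) (edges G))
    where
    _∈ₑ?_ : ∀ x (ed : Edge3 n) → Dec (x ∈ₑ ed)
    x ∈ₑ? ed = (x ≟ a ed) ⊎-dec (x ≟ b ed) ⊎-dec (x ≟ c ed)

  -- The inequalities are essential: `HasEdge` alone also holds for repeated vertices of an edge.
  Link : Fin n → Rel (Fin n) 0ℓ
  Link w u v = HasEdge G w u v × w ≢ u × w ≢ v × u ≢ v

  Link? : ∀ w → Decidable (Link w)
  Link? w u v = HasEdge? w u v ×-dec ¬? (w ≟ u) ×-dec ¬? (w ≟ v) ×-dec ¬? (u ≟ v)

  Link-sym : ∀ {w} → Symmetric (Link w)
  Link-sym ((ed , ed∈ , w∈ , u∈ , v∈) , w≢u , w≢v , u≢v) = (ed , ed∈ , w∈ , v∈ , u∈) , w≢v , w≢u , ≢-sym u≢v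

  Link-swap : ∀ {w u v} → Link w u v → Link u w v
  Link-swap ((ed , ed∈ , w∈ , u∈ , v∈) , w≢u , w≢v , u≢v) = (ed , ed∈ , u∈ , w∈ , v∈) , ≢-sym w≢u , u≢v , w≢v

  stars⇒ContainsSt3 : ∀ {R : Rel (Fin n) 0ℓ} {w h k} → (∀ {u v} → R u v → Link w u v) →
    1 ≤ k → Stars R k h [] → ContainsSt3 G h k
  stars⇒ContainsSt3 {R} {w} {h} {suc k} R⇒Link (s≤s _) ss = φ , φ-injective , λ i j → proj₁ (link i j)
    where
    open Star
    φ : StVertex h (suc k) → Fin n
    φ (inj₁ _)              = w
    φ (inj₂ (inj₁ i))       = centre (star ss i)
    φ (inj₂ (inj₂ (i , j))) = leaf (star ss i) j
    link : ∀ i j → Link w (centre (star ss i)) (leaf (star ss i) j)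
    link i j = R⇒Link (adjacent (star ss i) j)
    w≢centre : ∀ i → w ≢ centre (star ss i)
    -- As k is positive, the centre has a first leaf, and the edge through that leaf separates the
    -- centre from `w`.
    w≢centre i = let _ , w≢c , _ = link i zero in w≢c
    w≢leaf : ∀ i j → w ≢ leaf (star ss i) j
    w≢leaf i j = let _ , _ , w≢l , _ = link i j in w≢l
    leaf∈ : ∀ i j → leaf (star ss i) j ∈ vertices (star ss i)
    leaf∈ i j = there (∈-tabulate⁺ {f = leaf (star ss i)} j)
    centre≢leaf : ∀ i i′ j → centre (star ss i) ≢ leaf (star ss i′) j
    centre≢leaf i i′ j eq
      -- A common vertex puts both in the same star, where the link keeps centre and leaf apart.
      with refl ← star-unique ss i i′ (here refl) (subst (_∈ _) (sym eq) (leaf∈ i′ j))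
      = let _ , _ , _ , c≢l = link i j in c≢l eq
    φ-injective : Injective _≡_ _≡_ φ
    φ-injective {inj₁ _} {inj₁ _} eq = refl
    φ-injective {inj₁ _} {inj₂ (inj₁ i)} eq = contradiction eq (w≢centre i)
    φ-injective {inj₁ _} {inj₂ (inj₂ (i , j))} eq = contradiction eq (w≢leaf i j)
    φ-injective {inj₂ (inj₁ i)} {inj₁ _} eq = contradiction (sym eq) (w≢centre i)
    φ-injective {inj₂ (inj₂ (i , j))} {inj₁ _} eq = contradiction (sym eq) (w≢leaf i j)
    φ-injective {inj₂ (inj₁ i)} {inj₂ (inj₁ i′)} eq =
      cong (inj₂ ∘ inj₁) (star-unique ss i i′ (here refl) (here eq))
    φ-injective {inj₂ (inj₁ i)} {inj₂ (inj₂ (i′ , j))} eq = contradiction eq (centre≢leaf i i′ j)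
    φ-injective {inj₂ (inj₂ (i , j))} {inj₂ (inj₁ i′)} eq = contradiction (sym eq) (centre≢leaf i′ i j)
    φ-injective {inj₂ (inj₂ (i , j))} {inj₂ (inj₂ (i′ , j′))} eq
      with refl ← star-unique ss i i′ (leaf∈ i j) (subst (_∈ _) (sym eq) (leaf∈ i′ j′))
      = cong (λ j → inj₂ (inj₂ (i , j))) (leaf-injective (star ss i) eq)

  -- The number of edges through a pair, taken as a degree in the link, so that a heavy partner of
  -- `w` is a vertex of large degree in the link of `w`.
  codegree : Fin n → Fin n → ℕ
  codegree w u = degree (Link? w) u

  codegree-comm : ∀ w u → codegree w u ≡ codegree u w
  codegree-comm w u = cong length (filter-≐ (Link? w u) (Link? u w) (Link-swap , Link-swap) (allFin n))

  -- Heavy pairs and thinned links.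

  module _ (D : ℕ) where

    Heavy : Rel (Fin n) 0ℓ
    Heavy w u = D ≤ codegree w u

    Heavy? : Decidable Heavy
    Heavy? w u = D ≤? codegree w u

    Heavy-sym : Symmetric Heavy
    Heavy-sym {w} {u} = subst (D ≤_) (codegree-comm w u)

    Thin : Fin n → Rel (Fin n) 0ℓ
    Thin w u v = Link w u v × ((¬ Heavy w u × ¬ Heavy w v) ⊎ Heavy u v)

    Thin? : ∀ w → Decidable (Thin w)
    Thin? w u v = Link? w u v ×-dec ((¬? (Heavy? w u) ×-dec ¬? (Heavy? w v)) ⊎-dec Heavy? u v)

    Thin-sym : ∀ {w} → Symmetric (Thin w)
    Thin-sym (l , t) = Link-sym l , Sum.map swap Heavy-sym t

    -- If `w u` is heavy, only the heavy partners of `u` survive as its neighbours. Otherwise `u`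
    -- has degree below `D` already in the full link.
    degree-Thin≤ : (∀ u → degree Heavy? u ≤ D) → ∀ w u → degree (Thin? w) u ≤ D
    degree-Thin≤ few w u = case Heavy? w u of λ where
      (yes wu) → ≤-trans
        (degree-mono (Thin? w) Heavy? λ { (_ , inj₁ (¬wu , _)) → contradiction wu ¬wu ; (_ , inj₂ uv) → uv })
        (few u)
      (no ¬wu) → ≤-trans (degree-mono (Thin? w) (Link? w) proj₁) (<⇒≤ (≰⇒> ¬wu))

    -- The first entry is the vertex in whose link the edge is kept. In the last case neither pair
    -- through `a` is heavy, so the link of `a` keeps `b c` whether it is heavy or not.
    triple : Edge3 n → Fin n × Fin n × Fin n
    triple ed with Heavy? (a ed) (b ed) | Heavy? (a ed) (c ed)
    ... | yes _ | _     = c ed , a ed , b ed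
    ... | no _  | yes _ = b ed , a ed , c ed
    ... | no _  | no _  = a ed , b ed , c ed

    triple-Thin : ∀ {ed} → ed ∈ edges G → let w , u , v = triple ed in Thin w u v
    triple-Thin {ed} ed∈ with Heavy? (a ed) (b ed) | Heavy? (a ed) (c ed)
    ... | yes ab | _      = ((ed , ed∈ , inj₂ (inj₂ refl) , inj₁ refl , inj₂ (inj₁ refl)) ,
                             ≢-sym (a≢c ed) , ≢-sym (b≢c ed) , a≢b ed) , inj₂ ab
    ... | no _   | yes ac = ((ed , ed∈ , inj₂ (inj₁ refl) , inj₁ refl , inj₂ (inj₂ refl)) ,
                             ≢-sym (a≢b ed) , b≢c ed , a≢c ed) , inj₂ ac
    ... | no ¬ab | no ¬ac = ((ed , ed∈ , inj₁ refl , inj₂ (inj₁ refl) , inj₂ (inj₂ refl)) ,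
                             a≢b ed , a≢c ed , b≢c ed) , inj₁ (¬ab , ¬ac)

    -- Equal triples from different cases would list the same three vertices in two different
    -- increasing orders.
    triple-injective : Injective _≡_ _≡_ triple
    triple-injective {ed@(edge a b c _ b<c)} {ed′@(edge a′ b′ c′ _ b′<c′)} eq
      with Heavy? a b | Heavy? a c | Heavy? a′ b′ | Heavy? a′ c′
    ... | yes _ | _     | yes _ | _     with refl ← eq = edge-≡ refl refl refl
    ... | yes _ | _     | no _  | yes _ with refl ← eq = contradiction b′<c′ (Fin.<-asym b<c)
    ... | yes _ | _     | no _  | no _  with refl ← eq = contradiction (a<c ed) (Fin.<-asym (a<b ed′))
    ... | no _  | yes _ | yes _ | _     with refl ← eq = contradiction b′<c′ (Fin.<-asym b<c)
    ... | no _  | yes _ | no _  | yes _ with refl ← eq = edge-≡ refl refl refl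
    ... | no _  | yes _ | no _  | no _  with refl ← eq = contradiction (a<b ed) (Fin.<-asym (a<b ed′))
    ... | no _  | no _  | yes _ | _     with refl ← eq = contradiction (a<b ed) (Fin.<-asym (a<c ed′))
    ... | no _  | no _  | no _  | yes _ with refl ← eq = contradiction (a<b ed) (Fin.<-asym (a<b ed′))
    ... | no _  | no _  | no _  | no _  with refl ← eq = edge-≡ refl refl refl

    -- The edges embed through `triple` into the union over `w` of the arcs of the thinned links,
    -- tagged by `w`.
    e≤ : ∀ {m} → (∀ w → length (arcs (Thin? w)) ≤ m) → e G ≤ n * m
    e≤ {m} bound = begin
      e G                           ≡⟨ length-map triple (edges G) ⟨
      length (map triple (edges G)) ≤⟨ Unique-⊆⇒length≤ (Unique.map⁺ triple-injective (unique G)) cover ⟩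
      length (concatMap thin (allFin n)) ≤⟨ length-concatMap-≤ thin (allFin n)
                                              (λ {w} _ → ≤-trans (≤-reflexive (length-map (w ,_) (arcs (Thin? w)))) (bound w)) ⟩
      length (allFin n) * m         ≡⟨ cong (_* m) (length-tabulate {n = n} (λ u → u)) ⟩
      n * m                         ∎
      where
      open ≤-Reasoning
      thin : Fin n → List (Fin n × Fin n × Fin n)
      thin w = map (w ,_) (arcs (Thin? w))
      cover : map triple (edges G) ⊆ concatMap thin (allFin n)
      cover t∈ with ∈-map⁻ triple t∈
      ... | ed , ed∈ , refl = ∈-concatMap⁺ thin (lose (∈-allFin _) (∈-map⁺ _ (∈-arcs⁺ (Thin? _) (triple-Thin ed∈))))

-- The numerical estimate and the case distinction.

size-bound : ∀ n h k → 1 ≤ k → let D = h * suc k in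
  n * (D * D + (D * D + n * k)) ≤ 9 * ((k * n ^ 2) ⊔ (h ^ 2 * k ^ 2 * n))
size-bound n h k 1≤k = begin
  n * (D * D + (D * D + n * k))      ≤⟨ *-monoʳ-≤ n (+-mono-≤ DD≤ (+-monoˡ-≤ (n * k) DD≤)) ⟩
  n * (E * E + (E * E + n * k))      ≡⟨ expand n h k ⟩
  k * n ^ 2 + 8 * (h ^ 2 * k ^ 2 * n)
    ≤⟨ +-mono-≤ (m≤m⊔n (k * n ^ 2) _) (*-monoʳ-≤ 8 (m≤n⊔m (k * n ^ 2) _)) ⟩
  9 * ((k * n ^ 2) ⊔ (h ^ 2 * k ^ 2 * n)) ∎
  where
  open ≤-Reasoning
  D = h * suc k
  -- For positive k, `suc k` is at most `k + k`. The two squares of `E` then give the coefficient 8,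
  -- and the term `n * k` brings the constant to 9.
  E = h * (k + k)
  DD≤ : D * D ≤ E * E
  DD≤ = *-mono-≤ D≤E D≤E
    where D≤E = *-monoʳ-≤ h (+-monoˡ-≤ k 1≤k)
  expand : ∀ n h k → n * (h * (k + k) * (h * (k + k)) + (h * (k + k) * (h * (k + k)) + n * k))
                     ≡ k * (n * (n * 1)) + 8 * (h * (h * 1) * (k * (k * 1)) * n)
  expand = solve-∀

dense⇒ContainsSt3 : ∀ n h k → 1 ≤ k → (G : Graph3 n) →
  9 * ((k * n ^ 2) ⊔ (h ^ 2 * k ^ 2 * n)) < e G → ContainsSt3 G h k
dense⇒ContainsSt3 n h k 1≤k G many with any? (λ w → h ≤? degree (Heavy? G (h * suc k)) w)
-- The first `h` heavy partners of `w` serve as centres, and `D` is exactly the budget of `h` stars.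
... | yes (w , h≤) = stars⇒ContainsSt3 G (λ l → l) 1≤k
  (subst (λ h → Stars (Link G w) k h []) |cs|≡h
    (starsAt (Link? G w) {D = D} cs [] (Unique.take⁺ h (neighbours-unique (Heavy? G D) w))
      (All.take⁺ h (All.all-filter (Heavy? G D w) (allFin n))) (λ ())
      (≤-reflexive (trans (+-identityʳ _) (cong (_* suc k) |cs|≡h)))))
  where
  D = h * suc k
  cs = take h (neighbours (Heavy? G D) w)
  |cs|≡h : length cs ≡ h
  |cs|≡h = trans (length-take h _) (m≤n⇒m⊓n≡m h≤)
... | no few
  -- The threshold is that of `greedyStars` with both `M` and `Δ` equal to `D`.
  with any? (λ w → suc (h * suc k * (h * suc k) + (h * suc k * (h * suc k) + n * k)) ≤? length (arcs (Thin? G (h * suc k) w)))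
... | yes (w , dense) = stars⇒ContainsSt3 G proj₁ 1≤k
  (greedyStars (Thin? G D w) (Thin-sym G D) (degree-Thin≤ G D few′ w) dense h [] (≤-reflexive (+-identityʳ _)))
  where
  D = h * suc k
  few′ : ∀ u → degree (Heavy? G D) u ≤ D
  -- Fewer than `h` heavy partners is weakened to at most `D`, the bound shared by both cases of
  -- `degree-Thin≤`.
  few′ u = ≤-trans (<⇒≤ (≰⇒> λ h≤ → few (u , h≤))) (m≤m*n h (suc k))
... | no sparse = contradiction many (≤⇒≯ (≤-trans
  (e≤ G (h * suc k) (λ w → ≮⇒≥ λ dense → sparse (w , dense))) (size-bound n h k 1≤k)))

theorem5p1 : ∃ λ (C : ℕ) → ∀ (n h k : ℕ) → 1 ≤ n → 1 ≤ h → 1 ≤ k →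
    (G : Graph3 n) → C * ((k * n ^ 2) ⊔ (h ^ 2 * k ^ 2 * n)) < e G →
    ContainsSt3 G h k
theorem5p1 = 9 , λ n h k _ _ → dense⇒ContainsSt3 n h k
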